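{- Let $A$ be a type with decidable equality and let $\mathbb B$ be the type of Booleans. If $\exists\mathrm{MPCF}_{A,\mathbb B,T}$ holds for all $T:\mathcal P((A\times\mathbb B)^*)$, then $\mathrm{GDC}_{A,\mathbb B,T}$ holds for all $T:\mathcal P((A\times\mathbb B)^*)$.
   Context: Setting: intuitionistic higher-order arithmetic with inductive types and extensional equality of predicates; no choice principle is assumed. $\mathcal P(A)$ denotes $A\to\mathrm{Prop}$, with $a\in P$ meaning $P(a)$. $A^*$ is the type of finite lists over $A$, $\varepsilon$ the empty list, $u@a$ the list $u$ with $a$ appended at the end; $a\in u$ means $a$ occurs in $u$. For $u:A^*$, $\alpha:\mathcal P(A)$, $u\subset\alpha$ means $\forall a,\ a\in u\to a\in\alpha$; a list $u$ determines the predicate $\langle u\rangle:=\lambda x.\,x\in u$. For $T:\mathcal P(A^*)$, $\langle T\rangle:=\{\alpha:\mathcal P(A)\mid\forall u^{A^*},\ u\subset\alpha\to u\in T\}$. For $P:\mathcal P(\mathcal P(A))$, $\lfloor P\rfloor:=\{u:A^*\mid\langle u\rangle\in P\}$. $B_\bot:=B+\mathbf 1$, with $b:B$ identified with its left injection and $\bot$ the extra element. $\mathrm{GDC}$: let $A,B$ be types and $T:\mathcal P((A\times B)^*)$. For $X:\mathcal P((A\times B)^*)$ put $\phi(X):=\{u\mid u\in\lfloor\langle T\rangle\rfloor\wedge\forall a^A,\ \neg(\exists b^B,\ (a,b)\in u)\to\exists b^B,\ u@(a,b)\in X\}$; $T_{AB\mathrm{ap}}$ is the greatest fixed point of $\phi$.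 $T$ is $A$-$B$-approximable if $\varepsilon\in T_{AB\mathrm{ap}}$. $T$ has an $A$-$B$-choice function if there is $f:A\to B$ such that every $u:(A\times B)^*$ with $u\subset\mathcal G(f)$ is in $T$, where $\mathcal G(f)=\{(a,b)\mid f(a)=b\}$. $\mathrm{GDC}_{A,B,T}$ is: if $T$ is $A$-$B$-approximable then $T$ has an $A$-$B$-choice function. $\exists\mathrm{MPCF}$: for $f:A\to B_\bot$, $\mathrm{dom}(f):=\lambda a.\,f(a)\neq\bot$ and $\mathcal G(f):=\{(a,b):A\times B\mid f(a)=b\}$. For $f,g:A\to B_\bot$, $g\prec f$ means there is $a:A$ with $a\notin\mathrm{dom}(f)$, $\mathrm{dom}(g)=\lambda x.\,(x\in\mathrm{dom}(f)\vee x=a)$, and $f(x)=g(x)$ for all $x\in\mathrm{dom}(f)$. $f\in\mathrm{Max}_{\mathrm{dpf}}(P)$ means $\mathcal G(f)\in P$ and for all $g:A\to B_\bot$, $g\prec f\to\mathcal G(g)\notin P$. For $T:\mathcal P((A\times B)^*)$, $\exists\mathrm{MPCF}_{A,B,T}$ is: $(\exists\alpha^{\mathcal P(A\times B)},\ \alpha\in\langle T\rangle)\to\exists f^{A\to B_\bot},\ f\in\mathrm{Max}_{\mathrm{dpf}}(\langle T\rangle)$. -}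

module Defs where

open import Data.Empty using (⊥)
open import Data.List using (List; []; _∷ʳ_)
open import Data.List.Membership.Propositional using () renaming (_∈_ to _∈ˡ_)
open import Data.Maybe using (Maybe; just; nothing)
open import Data.Product using (_×_; _,_; ∃-syntax)
open import Data.Sum using (_⊎_)
open import Function using (_⇔_)
open import Relation.Binary.PropositionalEquality using (_≡_)

-- Σ-types provide choice and Set has no impredicative universe of propositions.
-- The logic of Prop is therefore taken as a structure over the types in Set: a
-- type Ω of propositions, with proofs Pf, into which every type S (hence also one
-- quantifying over Ω) is reflected by the proposition ⌜ S ⌝ "S is inhabited".
-- The eliminator reaches propositions only, so no choice principle, not even
-- unique choice, comes with it. Proof irrelevance and propositional
-- extensionality are not needed.

record PropUniverse : Set₁ where
  field
    Ω     : Set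
    Pf    : Ω → Set
    ⌜_⌝   : Set → Ω
    intro : {S : Set} → S → Pf ⌜ S ⌝
    elim  : {S : Set} {p : Ω} → (S → Pf p) → Pf ⌜ S ⌝ → Pf p

-- A formula is a type built with ∀, →, × from proofs of propositions; atoms taken
-- from Set, ∃, ∨ and ⊥ are put under ∥_∥. For such S, ∥ S ∥ → S is derivable.

module Logic (𝕌 : PropUniverse) where

  open PropUniverse 𝕌 public

  infix 4 _∈_ _∉_ _⊂_ _⊑_ _≐_
  infix 3 ¬_

  ∥_∥ : Set → Set
  ∥ S ∥ = Pf ⌜ S ⌝

  ¬_ : Set → Set
  ¬ S = S → ∥ ⊥ ∥

  𝒫 : Set → Set
  𝒫 A = A → Ω

  _∈_ _∉_ : {A : Set} → A → 𝒫 A → Set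
  x ∈ P = Pf (P x)
  x ∉ P = ¬ (x ∈ P)

  _⊑_ _≐_ : {A : Set} → 𝒫 A → 𝒫 A → Set
  P ⊑ Q = ∀ x → x ∈ P → x ∈ Q
  P ≐ Q = ∀ x → (x ∈ P) ⇔ (x ∈ Q)

  ⟨_⟩ˡ : {A : Set} → List A → 𝒫 A
  ⟨ u ⟩ˡ x = ⌜ x ∈ˡ u ⌝

  _⊂_ : {A : Set} → List A → 𝒫 A → Set
  u ⊂ α = ⟨ u ⟩ˡ ⊑ α

  ⟨_⟩ : {A : Set} → 𝒫 (List A) → 𝒫 (𝒫 A)
  ⟨ T ⟩ α = ⌜ (∀ u → u ⊂ α → u ∈ T) ⌝

  ⌊_⌋ : {A : Set} → 𝒫 (𝒫 A) → 𝒫 (List A)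
  ⌊ P ⌋ u = P ⟨ u ⟩ˡ

  -- Knaster–Tarski: the union of all post-fixed points.
  gfp : {C : Set} → (𝒫 C → 𝒫 C) → 𝒫 C
  gfp Φ u = ⌜ (∃[ X ] X ⊑ Φ X × u ∈ X) ⌝

  module _ {C : Set} (Φ : 𝒫 C → 𝒫 C) where

    gfp-greatest : ∀ X → X ⊑ Φ X → X ⊑ gfp Φ
    gfp-greatest X X⊑ΦX u u∈X = intro (X , X⊑ΦX , u∈X)

    module _ (mono : ∀ {X Y} → X ⊑ Y → Φ X ⊑ Φ Y) where

      gfp-postfixed : gfp Φ ⊑ Φ (gfp Φ)
      gfp-postfixed u = elim λ (X , X⊑ΦX , u∈X) →
        mono (gfp-greatest X X⊑ΦX) u (X⊑ΦX u u∈X)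

      gfp-prefixed : Φ (gfp Φ) ⊑ gfp Φ
      gfp-prefixed = gfp-greatest (Φ (gfp Φ)) (mono gfp-postfixed)

  module _ {A B : Set} where

    𝒢 : (A → B) → 𝒫 (A × B)
    𝒢 f (x , y) = ⌜ f x ≡ y ⌝

    φ : 𝒫 (List (A × B)) → 𝒫 (List (A × B)) → 𝒫 (List (A × B))
    φ T X u = ⌜ u ∈ ⌊ ⟨ T ⟩ ⌋
              × (∀ x → ¬ ∥ (∃[ y ] (x , y) ∈ ⟨ u ⟩ˡ) ∥ → ∥ (∃[ y ] u ∷ʳ (x , y) ∈ X) ∥) ⌝

    φ-mono : ∀ T {X Y} → X ⊑ Y → φ T X ⊑ φ T Y
    φ-mono T X⊑Y u = elim λ (u∈⌊⟨T⟩⌋ , ext) →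
      intro (u∈⌊⟨T⟩⌋ , λ x x∉ → elim (λ (y , uy∈X) → intro (y , X⊑Y _ uy∈X)) (ext x x∉))

    _ap : 𝒫 (List (A × B)) → 𝒫 (List (A × B))
    T ap = gfp (φ T)

    Approximable : 𝒫 (List (A × B)) → Set
    Approximable T = [] ∈ T ap

    HasChoiceFunction : 𝒫 (List (A × B)) → Set
    HasChoiceFunction T = ∥ (∃[ f ] (∀ u → u ⊂ 𝒢 f → u ∈ T)) ∥

    dom : (A → Maybe B) → 𝒫 A
    dom f x = ⌜ ¬ ∥ f x ≡ nothing ∥ ⌝

    𝒢⊥ : (A → Maybe B) → 𝒫 (A × B)
    𝒢⊥ f (x , y) = ⌜ f x ≡ just y ⌝

    _≺_ : (g f : A → Maybe B) → Set
    g ≺ f = ∥ (∃[ a ] a ∉ dom f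
                    × dom g ≐ (λ x → ⌜ (x ∈ dom f ⊎ ∥ x ≡ a ∥) ⌝)
                    × (∀ x → x ∈ dom f → ∥ f x ≡ g x ∥)) ∥

    Max-dpf : 𝒫 (𝒫 (A × B)) → 𝒫 (A → Maybe B)
    Max-dpf P f = ⌜ 𝒢⊥ f ∈ P × (∀ g → g ≺ f → 𝒢⊥ g ∉ P) ⌝

  GDC : (A B : Set) → 𝒫 (List (A × B)) → Set
  GDC A B T = Approximable T → HasChoiceFunction T

  ∃MPCF : (A B : Set) → 𝒫 (List (A × B)) → Set
  ∃MPCF A B T = ∥ (∃[ α ] α ∈ ⟨ T ⟩) ∥ → ∥ (∃[ f ] f ∈ Max-dpf ⟨ T ⟩) ∥

{-# OPTIONS --safe #-}
-- For inhabited A, ∃MPCF yields excluded middle: for T = { u | a ∈ u → p }, a maximal f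
-- is defined at a only if p holds and undefined at a only if ¬ p holds, and whether f is
-- defined at a is decidable.
-- Given T with [] ∈ T ap, apply ∃MPCF to the set of lists contained in some member of
-- T ap. Suppose that a maximal f is undefined at a. Classically there are finite lists
-- u₀ and u₁, contained in f extended by (a , true) and by (a , false), that lie in no
-- member of T ap. The entries of u₀ ++ u₁ away from a belong to f, hence lie in some
-- v ∈ T ap, and v can be taken to contain (a , true) or (a , false); it then contains u₀
-- or u₁. So f is total.
module Submission where

open import Data.Bool using (Bool; true; false)
open import Data.Empty using (⊥)
open import Data.List using (List; []; _∷_; _∷ʳ_; _++_; [_]; filter)
open import Data.List.Membership.Propositional using (find) renaming (_∈_ to _∈ˡ_)
open import Data.List.Membership.Propositional.Properties
  using (∈-++⁺ˡ; ∈-++⁺ʳ; ∈-++⁻; ∈-filter⁺; ∈-filter⁻)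
open import Data.List.Relation.Unary.Any as Any using (Any; here; any?)
open import Data.Maybe using (Maybe; just; nothing; fromMaybe)
open import Data.Maybe.Properties using (just-injective)
open import Data.Product using (_×_; _,_; ∃-syntax)
open import Data.Sum using (inj₁; inj₂; [_,_]′)
open import Function using (_∘_; mk⇔)
open import Relation.Binary using (DecidableEquality)
open import Relation.Binary.PropositionalEquality using (_≡_; _≢_; refl; sym; trans)
open import Relation.Nullary using (yes; no; ¬?; contradiction)
open import Defs

module _ (𝕌 : PropUniverse) where
  open Logic 𝕌

  ⊥-elimᵖ : {p : Ω} → ∥ ⊥ ∥ → Pf p
  ⊥-elimᵖ = elim λ ()

  ⟨⟩-inhabited : {C : Set} {T : 𝒫 (List C)} →
    (∀ u → u ⊂ ⟨ [] ⟩ˡ → u ∈ T) → ∥ (∃[ α ] α ∈ ⟨ T ⟩) ∥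
  ⟨⟩-inhabited h = intro (⟨ [] ⟩ˡ , intro h)

  -- Closure under inclusion makes order and repetition of entries irrelevant, and lets a member of
  -- `X` be enlarged before a list is compared with it.
  ExtendsTo : {C : Set} → 𝒫 (List C) → 𝒫 (List C)
  ExtendsTo X u = ⌜ (∃[ v ] v ∈ X × u ⊂ ⟨ v ⟩ˡ) ⌝

  module _ {A B : Set} where

    -- Unfolding the fixed point once puts `v` in `⌊ ⟨ T ⟩ ⌋`, so all lists with entries from `v`
    -- are in `T`.
    extendsTo-ap⊑ : (T : 𝒫 (List (A × B))) → ExtendsTo (T ap) ⊑ T
    extendsTo-ap⊑ T u = elim λ (v , v∈ap , u⊂v) →
      elim (λ (v∈⌊⟨T⟩⌋ , _) → elim (λ h → h u u⊂v) v∈⌊⟨T⟩⌋)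
           (gfp-postfixed (φ T) (φ-mono T) v v∈ap)

    Total : (A → Maybe B) → Set
    Total f = ∀ x → ¬ (f x ≡ nothing)

    -- The default `b` is a dummy: totality rules out the `nothing` case.
    𝒢-fromMaybe⊑𝒢⊥ : (b : B) (f : A → Maybe B) → Total f → 𝒢 (fromMaybe b ∘ f) ⊑ 𝒢⊥ f
    𝒢-fromMaybe⊑𝒢⊥ b f total (x , y) with f x | total x
    ... | just _  | _  = elim λ { refl → intro refl }
    ... | nothing | ¬∅ = λ _ → ⊥-elimᵖ (¬∅ refl)

  module _ {A B : Set} (_≟_ : DecidableEquality A) where

    infixl 8 _[_↦_]
    _[_↦_] : (A → Maybe B) → A → B → A → Maybe B
    (f [ a ↦ b ]) x with x ≟ a
    ... | yes _ = just b
    ... | no _  = f x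

    update-same : ∀ f a b → (f [ a ↦ b ]) a ≡ just b
    update-same f a b with a ≟ a
    ... | yes _  = refl
    ... | no a≢a = contradiction refl a≢a

    update-other : ∀ f {a x} b → x ≢ a → (f [ a ↦ b ]) x ≡ f x
    update-other f {a} {x} b x≢a with x ≟ a
    ... | yes x≡a = contradiction x≡a x≢a
    ... | no _    = refl

    update-≺ : ∀ f a b → f a ≡ nothing → (f [ a ↦ b ]) ≺ f
    update-≺ f a b fa≡∅ = intro (a , a∉dom , (λ x → mk⇔ (to x) (from x)) , agree)
      where
      a∉dom : a ∉ dom f
      a∉dom = elim λ a∈ → a∈ (intro fa≡∅)

      to : ∀ x → x ∈ dom (f [ a ↦ b ]) → _
      to x x∈ with x ≟ a
      ... | yes x≡a = intro (inj₂ (intro x≡a))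
      ... | no _    = intro (inj₁ x∈)

      from : ∀ x → _ → x ∈ dom (f [ a ↦ b ])
      from x with x ≟ a
      ... | yes _  = λ _ → intro (elim λ ())
      ... | no x≢a = elim [ (λ x∈ → x∈) , elim (λ x≡a → contradiction x≡a x≢a) ]′

      agree : ∀ x → x ∈ dom f → ∥ f x ≡ (f [ a ↦ b ]) x ∥
      agree x x∈ with x ≟ a
      ... | yes refl = ⊥-elimᵖ (a∉dom x∈)
      ... | no _     = intro refl

    -- The update is `≺ f`, so maximality excludes it. This refutes a universal statement but does
    -- not yet produce a list outside `T`.
    update-∉ : ∀ T f {a} → f ∈ Max-dpf ⟨ T ⟩ → f a ≡ nothing → ∀ b →
               ¬ (∀ u → u ⊂ 𝒢⊥ (f [ a ↦ b ]) → u ∈ T)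
    update-∉ T f {a} f∈Max fa≡∅ b h =
      elim (λ (_ , max) → max _ (update-≺ f a b fa≡∅) (intro h)) f∈Max

    off : A → List (A × B) → List (A × B)
    off a = filter λ (x , _) → ¬? (x ≟ a)

    off-⊂ : ∀ {a b f u x y} → u ⊂ 𝒢⊥ (f [ a ↦ b ]) → (x , y) ∈ˡ u → x ≢ a →
            (x , y) ∈ 𝒢⊥ f
    off-⊂ {b = b} {f} u⊂ z∈u x≢a =
      elim (λ e → intro (trans (sym (update-other f b x≢a)) e)) (u⊂ _ (intro z∈u))

    -- Entries of `u` at `a` all carry the value `b`, since they lie in the graph of a function with
    -- value `b` there; the other entries are in `off a u`.
    ⊂-split : ∀ {a b f u v} → u ⊂ 𝒢⊥ (f [ a ↦ b ]) → off a u ⊂ ⟨ v ⟩ˡ → (a , b) ∈ˡ v →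
              u ⊂ ⟨ v ⟩ˡ
    ⊂-split {a} {b} {f} u⊂ off⊂v ab∈v (x , y) = elim go
      where
      go : (x , y) ∈ˡ _ → _
      go z∈u with x ≟ a
      ... | no x≢a   = off⊂v _ (intro (∈-filter⁺ (λ (x , _) → ¬? (x ≟ a)) z∈u x≢a))
      ... | yes refl =
        elim (λ e → transport (just-injective (trans (sym (update-same f a b)) e)))
             (u⊂ _ (intro z∈u))
        where
        transport : b ≡ y → (x , y) ∈ ⟨ _ ⟩ˡ
        transport refl = intro ab∈v

    -- Decidable equality settles whether `v` has an entry at `a`. If so, `v` itself serves; if not,
    -- the second clause of `φ` appends one.
    ap-cover : (T : 𝒫 (List (A × B))) (a : A) → ∀ v → v ∈ T ap →
      ∥ (∃[ w ] ∃[ b ] w ∈ T ap × (a , b) ∈ˡ w × (∀ z → z ∈ˡ v → z ∈ˡ w)) ∥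
    ap-cover T a v v∈ap with any? (λ (x , _) → x ≟ a) v
    ... | yes p with find p
    ...   | (_ , b) , ab∈v , refl = intro (v , b , v∈ap , ab∈v , λ _ z∈v → z∈v)
    ap-cover T a v v∈ap | no ¬p =
      elim (λ (_ , ext) → elim (λ (b , vb∈ap) →
              intro (v ∷ʳ (a , b) , b , vb∈ap , ∈-++⁺ʳ v (here refl) , λ _ → ∈-++⁺ˡ))
            (ext a (elim λ (_ , ab∈) → elim (λ ab∈v → contradiction (occurs ab∈v) ¬p) ab∈)))
           (gfp-postfixed (φ T) (φ-mono T) v v∈ap)
      where
      occurs : ∀ {b} → (a , b) ∈ˡ v → Any (λ (x , _) → x ≡ a) v
      occurs = Any.map λ { refl → refl }

    mpcf⇒dne : ((T : 𝒫 (List (A × B))) → ∃MPCF A B T) → A → B →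
               (p : Ω) → ¬ ¬ Pf p → Pf p
    mpcf⇒dne mpcf a b p ¬¬p = elim decide (mpcf T (⟨⟩-inhabited λ u u⊂∅ →
        intro λ y ay∈u → elim (λ ()) (u⊂∅ _ (intro ay∈u))))
      where
      T : 𝒫 (List (A × B))
      T u = ⌜ (∀ y → (a , y) ∈ˡ u → Pf p) ⌝

      decide : (∃[ f ] f ∈ Max-dpf ⟨ T ⟩) → Pf p
      decide (f , f∈Max) with f a in fa≡
      -- Given `p`, every list is in `T`, so the update of `f` at `a` would contradict maximality.
      ... | nothing = ⊥-elimᵖ (¬¬p λ pf → update-∉ T f f∈Max fa≡ b λ _ _ → intro λ _ _ → pf)
      -- The one-entry list at `a` lies in the graph of `f`, and its membership in `T` yields `p`.
      ... | just y  = elim (λ (f∈⟨T⟩ , _) → elim (λ h →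
          elim (λ k → k y (here refl))
               (h [ a , y ] λ { _ → elim λ { (here refl) → intro fa≡ } })) f∈⟨T⟩)
        f∈Max

  module _ {A : Set} (_≟_ : DecidableEquality A)
           (mpcf : (T : 𝒫 (List (A × Bool))) → ∃MPCF A Bool T)
           (T : 𝒫 (List (A × Bool))) where

    Max⇒Total : ∀ f → f ∈ Max-dpf ⟨ ExtendsTo (T ap) ⟩ → Total f
    Max⇒Total f f∈Max a fa≡∅ =
      -- The goal is absurdity, so no witness has to be extracted from a negated universal: `undef`
      -- asks for the membership of an arbitrary list, and `dne` allows its non-membership to be
      -- assumed.
      undef true λ u₀ u₀⊂ → dne (ExtendsTo (T ap) u₀) λ u₀∉ →
      undef false λ u₁ u₁⊂ → dne (ExtendsTo (T ap) u₁) λ u₁∉ →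
      clash u₀⊂ u₁⊂ u₀∉ u₁∉
      where
      undef = update-∉ _≟_ (ExtendsTo (T ap)) f f∈Max fa≡∅

      -- The point `a` where `f` is undefined supplies the inhabitant of `A`.
      dne = mpcf⇒dne _≟_ mpcf a true

      f⟨_⟩ : Bool → A → Maybe Bool
      f⟨ b ⟩ = _[_↦_] _≟_ f a b

      clash : ∀ {u₀ u₁} → u₀ ⊂ 𝒢⊥ f⟨ true ⟩ → u₁ ⊂ 𝒢⊥ f⟨ false ⟩ →
              u₀ ∉ ExtendsTo (T ap) → u₁ ∉ ExtendsTo (T ap) → ∥ ⊥ ∥
      clash {u₀} {u₁} u₀⊂ u₁⊂ u₀∉ u₁∉ = elim (λ (f∈ , _) → elim (λ h →
          elim (λ (v , v∈ap , w⊂v) → elim (absurd w⊂v) (ap-cover _≟_ T a v v∈ap))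
               (h w w⊂f)) f∈) f∈Max
        where
        -- The value that a cover takes at `a` is not known in advance, so one list must serve both
        -- cases; concatenation suffices because there are only two values.
        w = off _≟_ a (u₀ ++ u₁)

        w⊂f : w ⊂ 𝒢⊥ f
        w⊂f _ = elim λ z∈w →
          let z∈ , x≢a = ∈-filter⁻ (λ (x , _) → ¬? (x ≟ a)) z∈w
          in [ (λ z∈u₀ → off-⊂ _≟_ u₀⊂ z∈u₀ x≢a) , (λ z∈u₁ → off-⊂ _≟_ u₁⊂ z∈u₁ x≢a) ]′
               (∈-++⁻ u₀ z∈)

        off-⊂-w : ∀ {u} → (∀ {z} → z ∈ˡ u → z ∈ˡ (u₀ ++ u₁)) → off _≟_ a u ⊂ ⟨ w ⟩ˡ
        off-⊂-w inc _ = elim λ z∈ →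
          let z∈u , x≢a = ∈-filter⁻ (λ (x , _) → ¬? (x ≟ a)) z∈
          in intro (∈-filter⁺ (λ (x , _) → ¬? (x ≟ a)) (inc z∈u) x≢a)

        absurd : ∀ {v} → w ⊂ ⟨ v ⟩ˡ →
          (∃[ v′ ] ∃[ b ] v′ ∈ T ap × (a , b) ∈ˡ v′ × (∀ z → z ∈ˡ v → z ∈ˡ v′)) → ∥ ⊥ ∥
        absurd {v} w⊂v (v′ , b , v′∈ap , ab∈v′ , v⊂v′) = by-value b ab∈v′
          where
          off-⊂-v′ : ∀ {u} → (∀ {z} → z ∈ˡ u → z ∈ˡ (u₀ ++ u₁)) → off _≟_ a u ⊂ ⟨ v′ ⟩ˡ
          off-⊂-v′ inc z z∈ =
            elim (λ z∈v → intro (v⊂v′ z z∈v)) (w⊂v z (off-⊂-w inc z z∈))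

          by-value : ∀ b → (a , b) ∈ˡ v′ → ∥ ⊥ ∥
          by-value true  at = u₀∉ (intro (v′ , v′∈ap , ⊂-split _≟_ u₀⊂ (off-⊂-v′ {u₀} ∈-++⁺ˡ) at))
          by-value false at = u₁∉ (intro (v′ , v′∈ap , ⊂-split _≟_ u₁⊂ (off-⊂-v′ {u₁} (∈-++⁺ʳ u₀)) at))

    mpcf⇒gdc : GDC A Bool T
    mpcf⇒gdc []∈ap = elim (λ (f , f∈Max) → intro (fromMaybe true ∘ f , λ u u⊂g →
        elim (λ (f∈ , _) → elim (λ h → extendsTo-ap⊑ T u
            (h u λ z z∈u → 𝒢-fromMaybe⊑𝒢⊥ true f (Max⇒Total f f∈Max) z (u⊂g z z∈u))) f∈)
          f∈Max))
      -- Approximability enters here: a list drawn from the empty predicate is included in `[]`, a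
      -- member of `T ap`.
      (mpcf (ExtendsTo (T ap)) (⟨⟩-inhabited λ u u⊂∅ → intro ([] , []∈ap , u⊂∅)))

theorem33 : (𝕌 : PropUniverse) → let open Logic 𝕌 in
    (A : Set) → DecidableEquality A →
    ((T : 𝒫 (List (A × Bool))) → ∃MPCF A Bool T) →
    ((T : 𝒫 (List (A × Bool))) → GDC A Bool T)
theorem33 𝕌 A _≟_ mpcf T = mpcf⇒gdc 𝕌 _≟_ mpcf T
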